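{- Fix a metric space $M$ and a point $s\in M$, and consider algorithms with all servers starting at $s$. Suppose there is a constant $\rho$ such that for every $h\in\mathbb{N}$ there exists $k=k(h)$ for which the $(h,k)$-server problem on $M$ (all online and offline servers starting at $s$) admits a strictly $\rho$-competitive online algorithm. Then there exists a strictly $\rho$-competitive online algorithm for the infinite server problem on $(M,s)$.
   Context: Infinite server problem on $(M,s)$: $M$ is a metric space with metric $d$ and $s\in M$ is the source. An unbounded number of servers initially reside at $s$. A finite sequence of requests (points of $M$) is revealed one by one; each must be served immediately, without knowledge of future requests, by moving some server to the requested point. The cost is the total distance traveled by the servers. The $(h,k)$-server problem on $M$ ($k\ge h$) is defined similarly except that the online algorithm has $k$ servers and is compared against an optimal offline algorithm with $h$ servers. All online algorithms are deterministic. An online algorithm $ALG$ is strictly $\rho$-competitive if $ALG(\sigma)\le \rho\, OPT(\sigma)$ for every request sequence $\sigma$, where $OPT(\sigma)$ is the optimal offline cost (with $h$ servers in the $(h,k)$ case, with unboundedly many servers in the infinite server case). -}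

module Defs where

open import Data.Bool.Base using (if_then_else_)
open import Data.Fin.Base using (Fin)
import Data.Fin.Properties as Fin
open import Data.List.Base using (List; []; _∷_)
open import Data.List.Relation.Binary.Pointwise using (Pointwise)
open import Data.Nat.Base as ℕ using (ℕ)
import Data.Nat.Properties as ℕ
open import Data.Product.Base using (_×_; _,_; ∃-syntax)
import Data.Product.Relation.Binary.Pointwise.NonDependent as Product
open import Data.Rational.Base as ℚ using (ℚ; 0ℚ; 1ℚ; ½; ∣_∣)
import Data.Rational.Properties as ℚ
open import Data.Rational.Solver using (module +-*-Solver)
import Function.Metric.Structures as Metric
open import Level using (_⊔_; suc)
open import Relation.Binary.Core using (Rel)
open import Relation.Binary.Definitions using (DecidableEquality)
open import Relation.Binary.PropositionalEquality.Core
  using (_≡_; refl; sym; trans; cong; cong₂)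
open import Relation.Nullary.Decidable.Core using (does)

-- Real numbers are Cauchy sequences of rationals, compared by the setoid
-- equality _≃_ below.

IsCauchy : (ℕ → ℚ) → Set
IsCauchy x = ∀ ε → 0ℚ ℚ.< ε →
  ∃[ N ] (∀ m n → N ℕ.≤ m → N ℕ.≤ n → ∣ x m ℚ.- x n ∣ ℚ.≤ ε)

private

  ½-pos : ∀ {ε} → 0ℚ ℚ.< ε → 0ℚ ℚ.< ½ ℚ.* ε
  ½-pos {ε} 0<ε = ℚ.positive⁻¹ (½ ℚ.* ε)
    {{ℚ.pos*pos⇒pos ½ ε {{ℚ.positive 0<ε}}}}

  ½+½ : ∀ ε → ½ ℚ.* ε ℚ.+ ½ ℚ.* ε ≡ ε
  ½+½ ε = begin-equality
    ½ ℚ.* ε ℚ.+ ½ ℚ.* ε  ≡⟨ ℚ.*-distribʳ-+ ε ½ ½ ⟨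
    1ℚ ℚ.* ε             ≡⟨ ℚ.*-identityˡ ε ⟩
    ε                    ∎
    where open ℚ.≤-Reasoning

  abstract
    const-cauchy : ∀ q → IsCauchy (λ _ → q)
    const-cauchy q ε 0<ε = 0 , λ _ _ _ _ → begin
      ∣ q ℚ.- q ∣  ≡⟨ cong ∣_∣ (ℚ.+-inverseʳ q) ⟩
      0ℚ           ≤⟨ ℚ.<⇒≤ 0<ε ⟩
      ε            ∎
      where open ℚ.≤-Reasoning

  abstract
    +-cauchy : ∀ x y → IsCauchy x → IsCauchy y → IsCauchy (λ n → x n ℚ.+ y n)
    +-cauchy x y cx cy ε 0<ε
      with M , hx ← cx (½ ℚ.* ε) (½-pos 0<ε)
         | N , hy ← cy (½ ℚ.* ε) (½-pos 0<ε)
      = M ℕ.⊔ N , λ m n K≤m K≤n → begin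
      ∣ (x m ℚ.+ y m) ℚ.- (x n ℚ.+ y n) ∣
        ≡⟨ cong ∣_∣ (regroup (x m) (y m) (x n) (y n)) ⟩
      ∣ (x m ℚ.- x n) ℚ.+ (y m ℚ.- y n) ∣
        ≤⟨ ℚ.∣p+q∣≤∣p∣+∣q∣ (x m ℚ.- x n) (y m ℚ.- y n) ⟩
      ∣ x m ℚ.- x n ∣ ℚ.+ ∣ y m ℚ.- y n ∣
        ≤⟨ ℚ.+-mono-≤ (hx m n (ℕ.m⊔n≤o⇒m≤o M N K≤m) (ℕ.m⊔n≤o⇒m≤o M N K≤n))
                      (hy m n (ℕ.m⊔n≤o⇒n≤o M N K≤m) (ℕ.m⊔n≤o⇒n≤o M N K≤n)) ⟩
      ½ ℚ.* ε ℚ.+ ½ ℚ.* ε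
        ≡⟨ ½+½ ε ⟩
      ε ∎
      where
      open ℚ.≤-Reasoning
      regroup : ∀ a b c d → (a ℚ.+ b) ℚ.- (c ℚ.+ d) ≡ (a ℚ.- c) ℚ.+ (b ℚ.- d)
      regroup = solve 4 (λ a b c d →
        (a :+ b) :- (c :+ d) := (a :- c) :+ (b :- d)) refl
        where open +-*-Solver

  cauchy-bounded : ∀ x → IsCauchy x →
    ∃[ B ] 0ℚ ℚ.< B × ∃[ N ] (∀ n → N ℕ.≤ n → ∣ x n ∣ ℚ.≤ B)
  cauchy-bounded x cx with N , h ← cx 1ℚ (ℚ.positive⁻¹ 1ℚ) =
    1ℚ ℚ.+ ∣ x N ∣ ,
    ℚ.+-mono-<-≤ (ℚ.positive⁻¹ 1ℚ) (ℚ.nonNegative⁻¹ ∣ x N ∣ {{ℚ.∣-∣-nonNeg (x N)}}) ,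
    N , λ n N≤n → begin
    ∣ x n ∣                      ≡⟨ cong ∣_∣ (split (x n) (x N)) ⟩
    ∣ (x n ℚ.- x N) ℚ.+ x N ∣    ≤⟨ ℚ.∣p+q∣≤∣p∣+∣q∣ (x n ℚ.- x N) (x N) ⟩
    ∣ x n ℚ.- x N ∣ ℚ.+ ∣ x N ∣  ≤⟨ ℚ.+-monoˡ-≤ ∣ x N ∣ (h n N N≤n ℕ.≤-refl) ⟩
    1ℚ ℚ.+ ∣ x N ∣               ∎
    where
    open ℚ.≤-Reasoning
    split : ∀ a b → a ≡ (a ℚ.- b) ℚ.+ b
    split = solve 2 (λ a b → a := (a :- b) :+ b) refl
      where open +-*-Solver

  *-mono : ∀ {p q r s} → 0ℚ ℚ.≤ q → 0ℚ ℚ.≤ r →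
           p ℚ.≤ q → r ℚ.≤ s → p ℚ.* r ℚ.≤ q ℚ.* s
  *-mono {q = q} {r = r} 0≤q 0≤r p≤q r≤s = ℚ.≤-trans
    (ℚ.*-monoʳ-≤-nonNeg r {{ℚ.nonNegative 0≤r}} p≤q)
    (ℚ.*-monoˡ-≤-nonNeg q {{ℚ.nonNegative 0≤q}} r≤s)

  0≤∣_∣ : ∀ p → 0ℚ ℚ.≤ ∣ p ∣
  0≤∣ p ∣ = ℚ.nonNegative⁻¹ ∣ p ∣ {{ℚ.∣-∣-nonNeg p}}

  *-close : ∀ {A B δ} a b c d → 0ℚ ℚ.< A → 0ℚ ℚ.< δ →
    ∣ a ∣ ℚ.≤ A → ∣ d ∣ ℚ.≤ B → ∣ a ℚ.- c ∣ ℚ.≤ δ → ∣ b ℚ.- d ∣ ℚ.≤ δ →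
    ∣ a ℚ.* b ℚ.- c ℚ.* d ∣ ℚ.≤ A ℚ.* δ ℚ.+ δ ℚ.* B
  *-close {A} {B} {δ} a b c d 0<A 0<δ a≤A d≤B ac≤δ bd≤δ = begin
    ∣ a ℚ.* b ℚ.- c ℚ.* d ∣
      ≡⟨ cong ∣_∣ (regroup a b c d) ⟩
    ∣ a ℚ.* (b ℚ.- d) ℚ.+ (a ℚ.- c) ℚ.* d ∣
      ≤⟨ ℚ.∣p+q∣≤∣p∣+∣q∣ (a ℚ.* (b ℚ.- d)) ((a ℚ.- c) ℚ.* d) ⟩
    ∣ a ℚ.* (b ℚ.- d) ∣ ℚ.+ ∣ (a ℚ.- c) ℚ.* d ∣
      ≡⟨ cong₂ ℚ._+_ (ℚ.∣p*q∣≡∣p∣*∣q∣ a (b ℚ.- d)) (ℚ.∣p*q∣≡∣p∣*∣q∣ (a ℚ.- c) d) ⟩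
    ∣ a ∣ ℚ.* ∣ b ℚ.- d ∣ ℚ.+ ∣ a ℚ.- c ∣ ℚ.* ∣ d ∣
      ≤⟨ ℚ.+-mono-≤ (*-mono (ℚ.<⇒≤ 0<A) 0≤∣ b ℚ.- d ∣ a≤A bd≤δ)
                    (*-mono (ℚ.<⇒≤ 0<δ) 0≤∣ d ∣ ac≤δ d≤B) ⟩
    A ℚ.* δ ℚ.+ δ ℚ.* B ∎
    where
    open ℚ.≤-Reasoning
    regroup : ∀ a b c d → a ℚ.* b ℚ.- c ℚ.* d ≡ a ℚ.* (b ℚ.- d) ℚ.+ (a ℚ.- c) ℚ.* d
    regroup = solve 4 (λ a b c d →
      a :* b :- c :* d := a :* (b :- d) :+ (a :- c) :* d) refl
      where open +-*-Solver

  divide : ∀ C ε → 0ℚ ℚ.< C → 0ℚ ℚ.< ε → ∃[ δ ] 0ℚ ℚ.< δ × C ℚ.* δ ≡ ε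
  divide C ε 0<C 0<ε = C⁻¹ ℚ.* ε , 0<δ , Cδ≡ε
    where
    instance
      _ = ℚ.positive 0<C
      _ = ℚ.positive 0<ε
    C⁻¹ = (ℚ.1/ C) {{ℚ.pos⇒nonZero C}}
    0<δ : 0ℚ ℚ.< C⁻¹ ℚ.* ε
    0<δ = ℚ.positive⁻¹ (C⁻¹ ℚ.* ε) {{ℚ.pos*pos⇒pos C⁻¹ {{ℚ.1/pos⇒pos C}} ε}}
    Cδ≡ε : C ℚ.* (C⁻¹ ℚ.* ε) ≡ ε
    Cδ≡ε = trans (sym (ℚ.*-assoc C C⁻¹ ε))
      (trans (cong (ℚ._* ε) (ℚ.*-inverseʳ C {{ℚ.pos⇒nonZero C}})) (ℚ.*-identityˡ ε))

  split : ∀ A B ε → 0ℚ ℚ.< A → 0ℚ ℚ.< B → 0ℚ ℚ.< ε →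
    ∃[ δ ] 0ℚ ℚ.< δ × A ℚ.* δ ℚ.+ δ ℚ.* B ≡ ε
  split A B ε 0<A 0<B 0<ε
    with δ , 0<δ , Cδ≡ε ← divide (A ℚ.+ B) ε (ℚ.+-mono-<-≤ 0<A (ℚ.<⇒≤ 0<B)) 0<ε
    = δ , 0<δ , trans (cong (A ℚ.* δ ℚ.+_) (ℚ.*-comm δ B))
                      (trans (sym (ℚ.*-distribʳ-+ δ A B)) Cδ≡ε)

  abstract
    *-cauchy : ∀ x y → IsCauchy x → IsCauchy y → IsCauchy (λ n → x n ℚ.* y n)
    *-cauchy x y cx cy ε 0<ε =
      let A , 0<A , I , bx = cauchy-bounded x cx
          B , 0<B , J , by = cauchy-bounded y cy
          δ , 0<δ , total = split A B ε 0<A 0<B 0<ε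
          K , hx = cx δ 0<δ
          L , hy = cy δ 0<δ
      in (I ℕ.⊔ J) ℕ.⊔ (K ℕ.⊔ L) , λ m n N≤m N≤n →
        let IJ≤m = ℕ.m⊔n≤o⇒m≤o (I ℕ.⊔ J) (K ℕ.⊔ L) N≤m
            IJ≤n = ℕ.m⊔n≤o⇒m≤o (I ℕ.⊔ J) (K ℕ.⊔ L) N≤n
            KL≤m = ℕ.m⊔n≤o⇒n≤o (I ℕ.⊔ J) (K ℕ.⊔ L) N≤m
            KL≤n = ℕ.m⊔n≤o⇒n≤o (I ℕ.⊔ J) (K ℕ.⊔ L) N≤n
        in ℚ.≤-trans
          (*-close (x m) (y m) (x n) (y n) 0<A 0<δ
            (bx m (ℕ.m⊔n≤o⇒m≤o I J IJ≤m))
            (by n (ℕ.m⊔n≤o⇒n≤o I J IJ≤n))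
            (hx m n (ℕ.m⊔n≤o⇒m≤o K L KL≤m) (ℕ.m⊔n≤o⇒m≤o K L KL≤n))
            (hy m n (ℕ.m⊔n≤o⇒n≤o K L KL≤m) (ℕ.m⊔n≤o⇒n≤o K L KL≤n)))
          (ℚ.≤-reflexive total)

record ℝ : Set where
  constructor mkℝ
  field
    seq    : ℕ → ℚ
    cauchy : IsCauchy seq

open ℝ public

infix  4 _≤_ _≃_
infixl 6 _+_
infixl 7 _*_

_≤_ : Rel ℝ _
x ≤ y = ∀ ε → 0ℚ ℚ.< ε → ∃[ N ] (∀ n → N ℕ.≤ n → seq x n ℚ.≤ seq y n ℚ.+ ε)

_≃_ : Rel ℝ _
x ≃ y = x ≤ y × y ≤ x

0ℝ : ℝ
0ℝ = mkℝ (λ _ → 0ℚ) (const-cauchy 0ℚ)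

_+_ : ℝ → ℝ → ℝ
x + y = mkℝ (λ n → seq x n ℚ.+ seq y n) (+-cauchy (seq x) (seq y) (cauchy x) (cauchy y))

_*_ : ℝ → ℝ → ℝ
x * y = mkℝ (λ n → seq x n ℚ.* seq y n) (*-cauchy (seq x) (seq y) (cauchy x) (cauchy y))

record MetricSpace a ℓ : Set (suc (a ⊔ ℓ)) where
  infix 4 _≈_
  field
    Carrier  : Set a
    _≈_      : Rel Carrier ℓ
    d        : Carrier → Carrier → ℝ
    isMetric : Metric.IsGeneralMetric _≈_ _≃_ _≤_ 0ℝ _+_ d

data Fleet : Set where
  finite    : ℕ → Fleet
  unbounded : Fleet

Server : Fleet → Set
Server (finite n) = Fin n
Server unbounded  = ℕ

server-≟ : ∀ F → DecidableEquality (Server F)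
server-≟ (finite n) = Fin._≟_
server-≟ unbounded  = ℕ._≟_

module ServerProblem {a ℓ} (M : MetricSpace a ℓ) (s : MetricSpace.Carrier M) where

  open MetricSpace M renaming (Carrier to Point)

  module _ (F : Fleet) where

    Configuration : Set a
    Configuration = Server F → Point

    -- The reaction to a single request: finitely many servers are moved, one
    -- after the other. Repositioning servers other than the one that serves
    -- the request is allowed, so algorithms need not be lazy.
    Moves : Set a
    Moves = List (Server F × Point)

    atSource : Configuration
    atSource _ = s

  module _ {F : Fleet} where

    move : Configuration F → Server F → Point → Configuration F
    move C i p j = if does (server-≟ F j i) then p else C j

    perform : Configuration F → Moves F → Configuration F
    perform C []             = C
    perform C ((i , p) ∷ ms) = perform (move C i p) ms

    distance : Configuration F → Moves F → ℝ
    distance C []             = 0ℝ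
    distance C ((i , p) ∷ ms) = d (C i) p + distance (move C i p) ms

    Covers : Configuration F → Point → Set ℓ
    Covers C r = ∃[ i ] C i ≈ r

    -- The ways of serving a request sequence (earliest request first) from a
    -- given configuration.
    data Schedule : Configuration F → List Point → Set (a ⊔ ℓ) where
      []  : ∀ {C} → Schedule C []
      _∷_ : ∀ {C r σ} ((ms , _) : ∃[ ms ] Covers (perform C ms) r) →
            Schedule (perform C ms) σ → Schedule C (r ∷ σ)

    cost : ∀ {C σ} → Schedule C σ → ℝ
    cost []                     = 0ℝ
    cost (_∷_ {C} (ms , _) τ) = distance C ms + cost τ

    -- Histories list the past requests, the most recent first.
    configuration : (List Point → Point → Moves F) → List Point → Configuration F
    configuration respond []      = atSource F
    configuration respond (r ∷ h) = perform (configuration respond h) (respond h r)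

  IsOPT : Fleet → List Point → ℝ → Set (a ⊔ ℓ)
  IsOPT F σ c = (∃[ τ ] cost {F} {atSource F} {σ} τ ≃ c)
              × (∀ (τ : Schedule (atSource F) σ) → c ≤ cost τ)

  record OnlineAlgorithm (F : Fleet) : Set (a ⊔ ℓ) where
    field
      respond : List Point → Point → Moves F
      serves  : ∀ h r → Covers (configuration respond (r ∷ h)) r
      -- A function of the points of M must respect the equality of M.
      respond-cong : ∀ {h h′ r r′} → Pointwise _≈_ h h′ → r ≈ r′ →
        Pointwise (Product.Pointwise _≡_ _≈_) (respond h r) (respond h′ r′)

    run : ∀ h σ → Schedule (configuration respond h) σ
    run h []      = []
    run h (r ∷ σ) = (respond h r , serves h r) ∷ run (r ∷ h) σ

    ALG : List Point → ℝ
    ALG σ = cost (run [] σ)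

  StrictlyCompetitive : ℝ → (offline online : Fleet) → OnlineAlgorithm online → Set (a ⊔ ℓ)
  StrictlyCompetitive ρ offline online A =
    ∀ σ opt → IsOPT offline σ opt → OnlineAlgorithm.ALG A σ ≤ ρ * opt

{-# OPTIONS --safe #-}

-- Every online algorithm with finitely many servers can be made lazy, moving
-- one server per request, at no extra cost. After naming its servers in the
-- order in which they leave the source, only n + 1 reactions to the request
-- after n earlier ones are left. Hence, given one algorithm for each fleet
-- size, a pigeonhole argument along each history produces a limit algorithm
-- which on every single request sequence coincides with infinitely many of
-- the given ones. Since an optimal schedule of the infinite server problem
-- moves only finitely many servers, its cost is also the optimal cost for all
-- sufficiently large fleets, among them one whose algorithm coincides with the
-- limit on the sequence considered.
module Submission where

open import Defs
open import Level using (Level; _⊔_; Lift; lift; lower; 0ℓ)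
open import Algebra.Bundles using (CommutativeMonoid)
import Algebra.Properties.CommutativeMonoid.Sum as Sum
open import Axiom.DoubleNegationElimination using (em⇒dne)
open import Axiom.ExcludedMiddle using (ExcludedMiddle)
open import Data.Bool.Base using (if_then_else_)
open import Data.Empty using (⊥-elim)
open import Data.Fin.Base as Fin using (Fin; toℕ; fromℕ<; punchIn)
open import Data.Fin.Properties
  using (toℕ-injective; toℕ-fromℕ<; punchInᵢ≢i)
open import Data.List.Base using (List; []; _∷_; _++_; _ʳ++_; length; map)
open import Data.List.Relation.Binary.Pointwise using (Pointwise; []; _∷_)
import Data.List.Relation.Binary.Pointwise as Pointwise
open import Data.List.Relation.Unary.All as All using (All; []; _∷_)
import Data.List.Relation.Unary.All.Properties as All
open import Data.Nat.Base as ℕ using (ℕ; zero; suc; _⊓_)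
open import Data.Nat.Induction using (<-rec)
import Data.Nat.Properties as ℕ
open import Data.Product.Base using (_×_; _,_; ∃-syntax; proj₁; proj₂; map₁)
import Data.Product.Relation.Binary.Pointwise.NonDependent as Product
open import Data.Rational.Base as ℚ using (0ℚ; ½)
import Data.Rational.Properties as ℚ
open import Data.Rational.Solver using (module +-*-Solver)
open import Data.Sum.Base using (inj₁; inj₂)
open import Data.Unit.Base using (⊤; tt)
open import Data.Vec.Functional using (Vector)
open import Function.Base using (_∘_)
import Function.Metric.Structures as Metric
open import Relation.Binary.Bundles using (Poset)
open import Relation.Binary.PropositionalEquality
  using (_≡_; _≢_; _≗_; refl; sym; trans; cong; cong₂; subst)
import Relation.Binary.Reasoning.PartialOrder as PartialOrderReasoning
open import Relation.Nullary.Decidable using (yes; no; does; map′; dec-true; dec-false)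
open import Relation.Nullary.Negation.Core using (¬_)

-- Order and addition of real numbers

½-pos : ∀ {ε} → 0ℚ ℚ.< ε → 0ℚ ℚ.< ½ ℚ.* ε
½-pos {ε} 0<ε = ℚ.positive⁻¹ (½ ℚ.* ε)
  {{ℚ.pos*pos⇒pos ½ ε {{ℚ.positive 0<ε}}}}

½+½ : ∀ ε → ½ ℚ.* ε ℚ.+ ½ ℚ.* ε ≡ ε
½+½ ε = trans (sym (ℚ.*-distribʳ-+ ε ½ ½)) (ℚ.*-identityˡ ε)

≤-pointwise : ∀ x y → (∀ n → seq x n ℚ.≤ seq y n) → x ≤ y
≤-pointwise x y x≤y ε 0<ε = 0 , λ n _ → begin
  seq x n          ≤⟨ x≤y n ⟩
  seq y n          ≡⟨ ℚ.+-identityʳ (seq y n) ⟨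
  seq y n ℚ.+ 0ℚ   ≤⟨ ℚ.+-monoʳ-≤ (seq y n) (ℚ.<⇒≤ 0<ε) ⟩
  seq y n ℚ.+ ε    ∎
  where open ℚ.≤-Reasoning

≃-pointwise : ∀ x y → seq x ≗ seq y → x ≃ y
≃-pointwise x y x≡y = ≤-pointwise x y (ℚ.≤-reflexive ∘ x≡y)
                    , ≤-pointwise y x (ℚ.≤-reflexive ∘ sym ∘ x≡y)

≤-refl : ∀ {x} → x ≤ x
≤-refl {x} = ≤-pointwise x x λ _ → ℚ.≤-refl

≤-trans : ∀ {x y z} → x ≤ y → y ≤ z → x ≤ z
≤-trans {x} {y} {z} x≤y y≤z ε 0<ε
  with M , hx ← x≤y (½ ℚ.* ε) (½-pos 0<ε)
     | N , hy ← y≤z (½ ℚ.* ε) (½-pos 0<ε)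
  = M ℕ.⊔ N , λ n K≤n → begin
  seq x n
    ≤⟨ hx n (ℕ.m⊔n≤o⇒m≤o M N K≤n) ⟩
  seq y n ℚ.+ ½ ℚ.* ε
    ≤⟨ ℚ.+-monoˡ-≤ (½ ℚ.* ε) (hy n (ℕ.m⊔n≤o⇒n≤o M N K≤n)) ⟩
  seq z n ℚ.+ ½ ℚ.* ε ℚ.+ ½ ℚ.* ε
    ≡⟨ ℚ.+-assoc (seq z n) (½ ℚ.* ε) (½ ℚ.* ε) ⟩
  seq z n ℚ.+ (½ ℚ.* ε ℚ.+ ½ ℚ.* ε)
    ≡⟨ cong (seq z n ℚ.+_) (½+½ ε) ⟩
  seq z n ℚ.+ ε ∎
  where open ℚ.≤-Reasoning

+-mono-≤ : ∀ {x y u v} → x ≤ y → u ≤ v → x + u ≤ y + v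
+-mono-≤ {x} {y} {u} {v} x≤y u≤v ε 0<ε
  with M , hx ← x≤y (½ ℚ.* ε) (½-pos 0<ε)
     | N , hu ← u≤v (½ ℚ.* ε) (½-pos 0<ε)
  = M ℕ.⊔ N , λ n K≤n → begin
  seq x n ℚ.+ seq u n
    ≤⟨ ℚ.+-mono-≤ (hx n (ℕ.m⊔n≤o⇒m≤o M N K≤n)) (hu n (ℕ.m⊔n≤o⇒n≤o M N K≤n)) ⟩
  (seq y n ℚ.+ ½ ℚ.* ε) ℚ.+ (seq v n ℚ.+ ½ ℚ.* ε)
    ≡⟨ regroup (seq y n) (seq v n) (½ ℚ.* ε) ⟩
  (seq y n ℚ.+ seq v n) ℚ.+ (½ ℚ.* ε ℚ.+ ½ ℚ.* ε)
    ≡⟨ cong ((seq y n ℚ.+ seq v n) ℚ.+_) (½+½ ε) ⟩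
  (seq y n ℚ.+ seq v n) ℚ.+ ε ∎
  where
  open ℚ.≤-Reasoning
  regroup : ∀ p q h → (p ℚ.+ h) ℚ.+ (q ℚ.+ h) ≡ (p ℚ.+ q) ℚ.+ (h ℚ.+ h)
  regroup = solve 3 (λ p q h → (p :+ h) :+ (q :+ h) := (p :+ q) :+ (h :+ h)) refl
    where open +-*-Solver

≤-poset : Poset 0ℓ 0ℓ 0ℓ
≤-poset = record
  { Carrier        = ℝ
  ; _≈_            = _≃_
  ; _≤_            = _≤_
  ; isPartialOrder = record
    { isPreorder = record
      { isEquivalence = record
        { refl  = λ {x} → ≤-refl {x} , ≤-refl {x}
        ; sym   = λ (x≤y , y≤x) → y≤x , x≤y
        ; trans = λ {x} {y} {z} (x≤y , y≤x) (y≤z , z≤y) →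
            ≤-trans {x} {y} {z} x≤y y≤z , ≤-trans {z} {y} {x} z≤y y≤x
        }
      ; reflexive = proj₁
      ; trans     = λ {x} {y} {z} → ≤-trans {x} {y} {z}
      }
    ; antisym = _,_
    }
  }

open Poset ≤-poset using () renaming (module Eq to ≃)

+-0-commutativeMonoid : CommutativeMonoid 0ℓ 0ℓ
+-0-commutativeMonoid = record
  { Carrier = ℝ
  ; _≈_     = _≃_
  ; _∙_     = _+_
  ; ε       = 0ℝ
  ; isCommutativeMonoid = record
    { isMonoid = record
      { isSemigroup = record
        { isMagma = record
          { isEquivalence = ≃.isEquivalence
          ; ∙-cong = λ {x} {y} {u} {v} (x≤y , y≤x) (u≤v , v≤u) →
              +-mono-≤ {x} {y} {u} {v} x≤y u≤v , +-mono-≤ {y} {x} {v} {u} y≤x v≤u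
          }
        ; assoc = λ x y z → ≃-pointwise (x + y + z) (x + (y + z))
            λ n → ℚ.+-assoc (seq x n) (seq y n) (seq z n)
        }
      ; identity = (λ x → ≃-pointwise (0ℝ + x) x λ n → ℚ.+-identityˡ (seq x n))
                 , (λ x → ≃-pointwise (x + 0ℝ) x λ n → ℚ.+-identityʳ (seq x n))
      }
    ; comm = λ x y → ≃-pointwise (x + y) (y + x) λ n → ℚ.+-comm (seq x n) (seq y n)
    }
  }

open CommutativeMonoid +-0-commutativeMonoid
  using (∙-cong; ∙-congˡ; ∙-congʳ; assoc; comm; identityˡ; identityʳ)
open Sum +-0-commutativeMonoid
  using (sum; sum-remove; sum-cong-≗; sum-cong-≋; sum-replicate-zero)

module ≤-Reasoning = PartialOrderReasoning ≤-poset

sum-nonNegative : ∀ {n} (t : Vector ℝ n) → (∀ i → 0ℝ ≤ t i) → 0ℝ ≤ sum t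
sum-nonNegative {zero}  t 0≤t = ≤-refl {0ℝ}
sum-nonNegative {suc n} t 0≤t = begin
  0ℝ                              ≈⟨ identityˡ 0ℝ ⟨
  0ℝ + 0ℝ                         ≤⟨ +-mono-≤ {0ℝ} {t Fin.zero} {0ℝ} {sum (t ∘ Fin.suc)}
                                       (0≤t Fin.zero)
                                       (sum-nonNegative (t ∘ Fin.suc) (0≤t ∘ Fin.suc)) ⟩
  t Fin.zero + sum (t ∘ Fin.suc)  ∎
  where open ≤-Reasoning

sum-zero : ∀ {n} (t : Vector ℝ n) → (∀ i → t i ≃ 0ℝ) → sum t ≃ 0ℝ
sum-zero {n} t t≃0 = ≃.trans {sum t} {sum {n} (λ _ → 0ℝ)} {0ℝ}
  (sum-cong-≋ {n} {t} t≃0) (sum-replicate-zero n)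

-- Splitting off the `i`-th term leaves equal remainders on both sides. The potential is bounded
-- this way both when a simulated server moves (`x` zero) and when a lazy one does (`y` zero).
sum-update : ∀ {n} (i : Fin n) (t t′ : Vector ℝ n) x y → (∀ j → j ≢ i → t′ j ≡ t j) →
  x + t′ i ≤ t i + y → x + sum t′ ≤ sum t + y
sum-update {suc n} i t t′ x y t′≡t le = begin
  x + sum t′            ≈⟨ ∙-congˡ {x} {sum t′} {t′ i + rest′} (sum-remove {i = i} t′) ⟩
  x + (t′ i + rest′)    ≈⟨ assoc x (t′ i) rest′ ⟨
  x + t′ i + rest′      ≡⟨ cong (x + t′ i +_) (sum-cong-≗ λ j →
                             t′≡t (punchIn i j) (punchInᵢ≢i i j)) ⟩
  x + t′ i + rest       ≤⟨ +-mono-≤ {x + t′ i} {t i + y} {rest} {rest} le (≤-refl {rest}) ⟩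
  t i + y + rest        ≈⟨ assoc (t i) y rest ⟩
  t i + (y + rest)      ≈⟨ ∙-congˡ {t i} {y + rest} {rest + y} (comm y rest) ⟩
  t i + (rest + y)      ≈⟨ assoc (t i) rest y ⟨
  t i + rest + y        ≈⟨ ∙-congʳ {y} {sum t} {t i + rest} (sum-remove {i = i} t) ⟨
  sum t + y             ∎
  where
  open ≤-Reasoning
  rest  = sum (t  ∘ punchIn i)
  rest′ = sum (t′ ∘ punchIn i)

-- Minima and frequent values in classical logic

lowerEM : ∀ p q → ExcludedMiddle (p ⊔ q) → ExcludedMiddle p
lowerEM p q em {P} = map′ lower lift (em {Lift q P})

Least : ∀ {p} → (ℕ → Set p) → Set p
Least P = ∃[ n ] (P n × (∀ {m} → P m → n ℕ.≤ m))

least : ∀ {p} {P : ℕ → Set p} → ExcludedMiddle p → ∃[ n ] P n → Least P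
least {P = P} em (n , pn) = <-rec (λ n → P n → Least P) step n pn
  where
  step : ∀ n → (∀ {m} → m ℕ.< n → P m → Least P) → P n → Least P
  step n rec pn with em {∃[ m ] (m ℕ.< n × P m)}
  ... | yes (m , m<n , pm) = rec m<n pm
  ... | no  none           = n , pn , λ {m} pm → ℕ.≮⇒≥ λ m<n → none (m , m<n , pm)

-- A least value depends only on which numbers satisfy the predicate, so choosing it makes choices
-- respect `_≈_`.
least-unique : ∀ {p} {P Q : ℕ → Set p} (x : Least P) (y : Least Q) →
  (∀ {n} → P n → Q n) → (∀ {n} → Q n → P n) → proj₁ x ≡ proj₁ y
least-unique (_ , px , x-min) (_ , qy , y-min) p⇒q q⇒p =
  ℕ.≤-antisym (x-min (q⇒p qy)) (y-min (p⇒q px))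

Frequent : (ℕ → Set) → Set
Frequent P = ∀ N → ∃[ n ] (N ℕ.≤ n × P n)

rare⇒bounded : ∀ {P : ℕ → Set} → ExcludedMiddle 0ℓ →
  ¬ Frequent P → ∃[ N ] (∀ n → N ℕ.≤ n → ¬ P n)
rare⇒bounded em rare = em⇒dne em λ never → rare λ N → em⇒dne em λ none →
  never (N , λ n N≤n pn → none (n , N≤n , pn))

-- Infinite pigeonhole by induction on `b`: if `b` itself is taken only rarely, it is avoided beyond
-- some `N`, and there the bound drops by one.
frequent-value : ∀ {P : ℕ → Set} (f : ℕ → ℕ) b → ExcludedMiddle 0ℓ →
  Frequent P → (∀ n → f n ℕ.≤ b) → ∃[ v ] Frequent (λ n → P n × f n ≡ v)
frequent-value {P} f b em P-frequent f≤b = go b λ N →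
  let n , N≤n , pn = P-frequent N in n , N≤n , pn , f≤b n
  where
  go : ∀ b → Frequent (λ n → P n × f n ℕ.≤ b) → ∃[ v ] Frequent (λ n → P n × f n ≡ v)
  go b frequent with em {Frequent (λ n → P n × f n ≡ b)}
  ... | yes b-frequent = b , b-frequent
  go zero    frequent | no 0-rare = ⊥-elim (0-rare λ N →
    let n , N≤n , pn , fn≤0 = frequent N in n , N≤n , pn , ℕ.n≤0⇒n≡0 fn≤0)
  go (suc b) frequent | no b-rare with N , avoids ← rare⇒bounded em b-rare = go b λ K →
    let n , N⊔K≤n , pn , fn≤1+b = frequent (N ℕ.⊔ K)
        fn≢1+b = λ eq → avoids n (ℕ.m⊔n≤o⇒m≤o N K N⊔K≤n) (pn , eq)
    in n , ℕ.m⊔n≤o⇒n≤o N K N⊔K≤n , pn , ℕ.<⇒≤pred (ℕ.≤∧≢⇒< fn≤1+b fn≢1+b)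

-- Transpositions and truncation of natural numbers

swap : ℕ → ℕ → ℕ → ℕ
swap m n k = if does (k ℕ.≟ m) then n else if does (k ℕ.≟ n) then m else k

swap-left : ∀ m n → swap m n m ≡ n
swap-left m n rewrite dec-true (m ℕ.≟ m) refl = refl

swap-right : ∀ m n → swap m n n ≡ m
swap-right m n with n ℕ.≟ m
... | yes refl = swap-left m m
... | no  n≢m  rewrite dec-false (n ℕ.≟ m) n≢m | dec-true (n ℕ.≟ n) refl = refl

swap-other : ∀ m n {k} → k ≢ m → k ≢ n → swap m n k ≡ k
swap-other m n {k} k≢m k≢n
  rewrite dec-false (k ℕ.≟ m) k≢m | dec-false (k ℕ.≟ n) k≢n = refl

swap-involutive : ∀ m n k → swap m n (swap m n k) ≡ k
swap-involutive m n k with k ℕ.≟ m | k ℕ.≟ n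
... | yes refl | _        = trans (cong (swap m n) (swap-left m n)) (swap-right m n)
... | no  _    | yes refl = trans (cong (swap m n) (swap-right m n)) (swap-left m n)
... | no  k≢m  | no  k≢n  =
  trans (cong (swap m n) (swap-other m n k≢m k≢n)) (swap-other m n k≢m k≢n)

swap-injective : ∀ m n {k l} → swap m n k ≡ swap m n l → k ≡ l
swap-injective m n {k} {l} eq = trans (sym (swap-involutive m n k))
  (trans (cong (swap m n) eq) (swap-involutive m n l))

swap-invariant : ∀ {a} {A : Set a} (f : ℕ → A) m n → f m ≡ f n → ∀ k → f (swap m n k) ≡ f k
swap-invariant f m n fm≡fn k with k ℕ.≟ m | k ℕ.≟ n
... | yes refl | _        = trans (cong f (swap-left m n)) (sym fm≡fn)
... | no  _    | yes refl = trans (cong f (swap-right m n)) fm≡fn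
... | no  k≢m  | no  k≢n  = cong f (swap-other m n k≢m k≢n)

clamp : ∀ m → ℕ → Fin (suc m)
clamp m n = fromℕ< (ℕ.s≤s (ℕ.m⊓n≤n n m))

toℕ-clamp : ∀ m n → toℕ (clamp m n) ≡ n ⊓ m
toℕ-clamp m n = toℕ-fromℕ< (ℕ.s≤s (ℕ.m⊓n≤n n m))

upper-bound : ∀ ns → ∃[ N ] All (ℕ._< N) ns
upper-bound []       = 0 , []
upper-bound (n ∷ ns) with N , ns<N ← upper-bound ns =
  suc n ℕ.⊔ N , ℕ.m≤m⊔n (suc n) N ∷ All.map (λ k<N → ℕ.≤-trans k<N (ℕ.m≤n⊔m (suc n) N)) ns<N

module _ {a ℓ} (M : MetricSpace a ℓ) (s : MetricSpace.Carrier M) where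

  open MetricSpace M renaming (Carrier to Point)
  open ServerProblem M s
  private module d = Metric.IsGeneralMetric isMetric

  -- Transfer of schedules between fleets

  -- Moving `f i` displaces every server with the same image, so a move of `i` transfers faithfully
  -- if `i` shares its image with no other. Servers that never move may be merged.
  Isolated : ∀ {F G} → (Server F → Server G) → Server F → Set
  Isolated f i = ∀ j → f j ≡ f i → j ≡ i

  moved : ∀ {F} {C : Configuration F} {σ} → Schedule C σ → List (Server F)
  moved []             = []
  moved ((ms , _) ∷ τ) = map proj₁ ms ++ moved τ

  module _ {F G : Fleet} (f : Server F → Server G) where

    rename : Moves F → Moves G
    rename = map (map₁ f)

    move-rename : ∀ {C X} i p → C ≗ X ∘ f → Isolated {F} {G} f i →
      move C i p ≗ move X (f i) p ∘ f
    move-rename i p C≗Xf isolated j with server-≟ F j i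
    ... | yes refl rewrite dec-true (server-≟ G (f j) (f j)) refl = refl
    ... | no  j≢i  rewrite dec-false (server-≟ G (f j) (f i)) (j≢i ∘ isolated j) = C≗Xf j

    perform-rename : ∀ {C X} ms → C ≗ X ∘ f → All (Isolated {F} {G} f) (map proj₁ ms) →
      perform C ms ≗ perform X (rename ms) ∘ f
    perform-rename []             C≗Xf []          = C≗Xf
    perform-rename {X = X} ((i , p) ∷ ms) C≗Xf (iso ∷ isos) =
      perform-rename {X = move X (f i) p} ms (move-rename {X = X} i p C≗Xf iso) isos

    distance-rename : ∀ {C X} ms → C ≗ X ∘ f → All (Isolated {F} {G} f) (map proj₁ ms) →
      distance C ms ≡ distance X (rename ms)
    distance-rename []             C≗Xf []          = refl
    distance-rename {X = X} ((i , p) ∷ ms) C≗Xf (iso ∷ isos) = cong₂ _+_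
      (cong (λ x → d x p) (C≗Xf i))
      (distance-rename {X = move X (f i) p} ms (move-rename {X = X} i p C≗Xf iso) isos)

    -- The invariant `C ≗ X ∘ f` puts each server where its image is, so corresponding moves have
    -- the same endpoints and covered requests stay covered.
    schedule-rename : ∀ {C X σ} (τ : Schedule C σ) → C ≗ X ∘ f →
      All (Isolated {F} {G} f) (moved τ) → ∃[ τ′ ] cost τ ≡ cost {G} {X} {σ} τ′
    schedule-rename []                         C≗Xf _    = [] , refl
    schedule-rename {X = X} {r ∷ _} ((ms , i , Ci≈r) ∷ τ) C≗Xf isos
      with isos₁ , isos₂ ← All.++⁻ (map proj₁ ms) isos
      with C′≗X′f ← perform-rename {X = X} ms C≗Xf isos₁
      with τ′ , eq ← schedule-rename {X = perform X (rename ms)} τ C′≗X′f isos₂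
      = (rename ms , f i , subst (_≈ r) (C′≗X′f i) Ci≈r) ∷ τ′
      , cong₂ _+_ (distance-rename {X = X} ms C≗Xf isos₁) eq

  -- A schedule moves only finitely many servers, and one further server is
  -- enough to stand for all those that stay at the source.
  OPT-finite : ∀ σ c → IsOPT unbounded σ c →
    ∃[ N ] (∀ m → N ℕ.≤ m → IsOPT (finite (suc m)) σ c)
  OPT-finite σ c ((τ , cost-τ≃c) , c-least)
    with N , moved<N ← upper-bound (moved τ)
    = N , λ m N≤m →
      let isolated : ∀ {i} → i ℕ.< N → Isolated {unbounded} {finite (suc m)} (clamp m) i
          isolated {i} i<N j eq = clamp-isolated m (ℕ.<-≤-trans i<N N≤m) j eq
          τ′ , eq = schedule-rename (clamp m) {X = atSource (finite (suc m))} τ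
                      (λ _ → refl) (All.map isolated moved<N)
      in (τ′ , subst (_≃ c) eq cost-τ≃c) ,
         -- No finite schedule beats `c`: the injection `toℕ` turns it into an unbounded one of the
         -- same cost.
         λ υ → let υ′ , eq = schedule-rename {finite (suc m)} {unbounded} toℕ
                     {X = atSource unbounded} υ (λ _ → refl) (All.universal (λ _ _ → toℕ-injective) (moved υ))
               in subst (c ≤_) (sym eq) (c-least υ′)
    where
    clamp-isolated : ∀ m {i} → i ℕ.< m → ∀ j → clamp m j ≡ clamp m i → j ≡ i
    clamp-isolated m {i} i<m j eq = trans (sym j⊓m≡j) j⊓m≡i
      where
      j⊓m≡i : j ⊓ m ≡ i
      j⊓m≡i = trans (sym (toℕ-clamp m j)) (trans (cong toℕ eq)
        (trans (toℕ-clamp m i) (ℕ.m≤n⇒m⊓n≡m (ℕ.<⇒≤ i<m))))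
      j⊓m≡j : j ⊓ m ≡ j
      j⊓m≡j with ℕ.⊓-sel j m
      ... | inj₁ eq = eq
      ... | inj₂ eq = ⊥-elim (ℕ.<-irrefl (trans (sym j⊓m≡i) eq) i<m)

  -- Lazy algorithms

  History : Set a
  History = List Point

  infix 4 _≋_
  _≋_ : History → History → Set (a ⊔ ℓ)
  _≋_ = Pointwise _≈_

  -- A request is served by the server choose h r. Since the new server is at
  -- most length h, servers n, n + 1, … are at the source after n requests.
  record Rule : Set (a ⊔ ℓ) where
    field
      choose      : History → Point → ℕ
      choose≤     : ∀ h r → choose h r ℕ.≤ length h
      choose-cong : ∀ {h h′ r r′} → h ≋ h′ → r ≈ r′ → choose h r ≡ choose h′ r′

  chase : (History → Point → ℕ) → History → Point → Moves unbounded
  chase choose h r = (choose h r , r) ∷ []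

  move-self : ∀ {F} (C : Configuration F) i p → move C i p i ≡ p
  move-self {F} C i p rewrite dec-true (server-≟ F i i) refl = refl

  move-other : ∀ {F} (C : Configuration F) {i j} p → j ≢ i → move C i p j ≡ C j
  move-other {F} C {i} {j} p j≢i rewrite dec-false (server-≟ F j i) j≢i = refl

  lazy : Rule → OnlineAlgorithm unbounded
  lazy R = record
    { respond      = chase choose
    ; serves       = λ h r → choose h r , d.EqC.reflexive
        (move-self (configuration (chase choose) h) (choose h r) r)
    ; respond-cong = λ h≋h′ r≈r′ → (choose-cong h≋h′ r≈r′ , r≈r′) ∷ []
    }
    where open Rule R

  -- Only the choices made on the way to the given history are compared; a run leading there depends
  -- on no others.
  Agree : (History → Point → ℕ) → (History → Point → ℕ) → History → Set
  Agree e e′ []      = ⊤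
  Agree e e′ (r ∷ h) = Agree e e′ h × e h r ≡ e′ h r

  module _ (R R′ : Rule) where
    open Rule R
    open Rule R′ using () renaming (choose to choose′)

    configuration-agree : ∀ h → Agree choose choose′ h →
      configuration (chase choose) h ≡ configuration (chase choose′) h
    configuration-agree []      _            = refl
    configuration-agree (r ∷ h) (agree , eq) =
      cong₂ (λ C i → move C i r) (configuration-agree h agree) eq

    agree-tail : ∀ h σ → Agree choose choose′ (σ ʳ++ h) → Agree choose choose′ h
    agree-tail h []      agree = agree
    agree-tail h (r ∷ σ) agree = proj₁ (agree-tail (r ∷ h) σ agree)

    -- As histories are reversed, `σ ʳ++ h` is the one reached from `h` by serving `σ`. Agreement
    -- along it covers both the configuration at `h` and every later move.
    run-agree : ∀ h σ → Agree choose choose′ (σ ʳ++ h) →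
      cost (OnlineAlgorithm.run (lazy R) h σ) ≡ cost (OnlineAlgorithm.run (lazy R′) h σ)
    run-agree h []      agree = refl
    run-agree h (r ∷ σ) agree with agree-h , eq ← agree-tail (r ∷ h) σ agree = cong₂ _+_
      (cong₂ (λ C i → d (C i) r + 0ℝ) (configuration-agree h agree-h) eq)
      (run-agree (r ∷ h) σ agree)

  -- Limits of sequences of lazy algorithms

  module Limit (em : ExcludedMiddle 0ℓ) (R : ℕ → Rule) where

    open module Given n = Rule (R n)

    -- Joint recursion on the history: `limit` takes the least server chosen by infinitely many
    -- surviving rules, `Survives` keeps the rules that made these choices throughout, and
    -- `frequent` is the invariant that lets the recursion go on. Thinning out along each history
    -- separately works for a space of any cardinality.
    Survives : History → ℕ → Set
    frequent : ∀ h → Frequent (Survives h)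
    limit    : ∀ h r → Least λ v → Frequent λ n → Survives h n × choose n h r ≡ v

    Survives []      n = ⊤
    Survives (r ∷ h) n = Survives h n × choose n h r ≡ proj₁ (limit h r)

    frequent []      N = N , ℕ.≤-refl , tt
    frequent (r ∷ h) = proj₁ (proj₂ (limit h r))

    limit h r = least em (frequent-value (λ n → choose n h r) (length h) em
      (frequent h) (λ n → choose≤ n h r))

    -- Mutual induction: the same survivors give the same frequent values, hence the same least one,
    -- and the same limit choices give the same survivors.
    survives-cong : ∀ {h h′} n → h ≋ h′ → Survives h n → Survives h′ n
    limit-cong    : ∀ {h h′ r r′} → h ≋ h′ → r ≈ r′ → proj₁ (limit h r) ≡ proj₁ (limit h′ r′)

    survives-cong n []             _          = tt
    survives-cong n (r≈r′ ∷ h≋h′) (surv , eq) = survives-cong n h≋h′ surv ,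
      trans (sym (choose-cong n h≋h′ r≈r′)) (trans eq (limit-cong h≋h′ r≈r′))

    limit-cong {h} {h′} {r} {r′} h≋h′ r≈r′ = least-unique (limit h r) (limit h′ r′)
      (λ freq N → let n , N≤n , surv , eq = freq N in
        n , N≤n , survives-cong n h≋h′ surv ,
        trans (sym (choose-cong n h≋h′ r≈r′)) eq)
      (λ freq N → let n , N≤n , surv , eq = freq N in
        n , N≤n , survives-cong n (Pointwise.symmetric d.EqC.sym h≋h′) surv ,
        trans (choose-cong n h≋h′ r≈r′) eq)

    limitRule : Rule
    limitRule = record
      { choose      = λ h r → proj₁ (limit h r)
      -- The limit value is the choice of some given rule, found by searching from index 0, and
      -- inherits its bound.
      ; choose≤     = λ h r → let n , _ , _ , eq = proj₁ (proj₂ (limit h r)) 0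
                              in subst (ℕ._≤ length h) eq (choose≤ n h r)
      ; choose-cong = limit-cong
      }

    survives⇒agree : ∀ h {n} → Survives h n → Agree (choose n) (Rule.choose limitRule) h
    survives⇒agree []      _           = tt
    survives⇒agree (r ∷ h) (surv , eq) = survives⇒agree h surv , eq

  -- Making an algorithm lazy

  perform-cong : ∀ {F} {C C′ : Configuration F} {ms ms′} → (∀ j → C j ≈ C′ j) →
    Pointwise (Product.Pointwise _≡_ _≈_) ms ms′ → ∀ j → perform C ms j ≈ perform C′ ms′ j
  perform-cong C≈C′ [] = C≈C′
  perform-cong {F} {C} {C′} {(i , p) ∷ _} {(_ , p′) ∷ _} C≈C′ ((refl , p≈p′) ∷ eqs) =
    perform-cong move-cong eqs
    where
    move-cong : ∀ j → move C i p j ≈ move C′ i p′ j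
    move-cong j with server-≟ F j i
    ... | yes _ = p≈p′
    ... | no  _ = C≈C′ j

  module Potential {k : ℕ} where

    -- A lower bound on what the lazy algorithm has saved, its servers being at L while
    -- those of the simulated algorithm are at C.
    potential : (L C : Configuration (finite k)) → ℝ
    potential L C = sum λ i → d (L i) (C i)

    -- By the triangle inequality, each move raises only the term of the moved server, by at most
    -- the distance travelled.
    perform-potential : ∀ L C ms → potential L (perform C ms) ≤ potential L C + distance C ms
    perform-potential L C []             = proj₂ (identityʳ (potential L C))
    perform-potential L C ((i , p) ∷ ms) = begin
      potential L (perform C′ ms)
        ≤⟨ perform-potential L C′ ms ⟩
      potential L C′ + distance C′ ms
        ≈⟨ ∙-congʳ {distance C′ ms} {0ℝ + potential L C′} {potential L C′}
             (identityˡ (potential L C′)) ⟨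
      0ℝ + potential L C′ + distance C′ ms
        ≤⟨ +-mono-≤ {0ℝ + potential L C′} {potential L C + d (C i) p}
             {distance C′ ms} {distance C′ ms} step (≤-refl {distance C′ ms}) ⟩
      potential L C + d (C i) p + distance C′ ms
        ≈⟨ assoc (potential L C) (d (C i) p) (distance C′ ms) ⟩
      potential L C + (d (C i) p + distance C′ ms) ∎
      where
      open ≤-Reasoning
      C′ = move C i p
      step : 0ℝ + potential L C′ ≤ potential L C + d (C i) p
      step = sum-update i (λ j → d (L j) (C j)) (λ j → d (L j) (C′ j)) 0ℝ (d (C i) p)
        (λ j j≢i → cong (d (L j)) (move-other C p j≢i)) (begin
        0ℝ + d (L i) (C′ i)    ≈⟨ identityˡ (d (L i) (C′ i)) ⟩
        d (L i) (C′ i)         ≡⟨ cong (d (L i)) (move-self C i p) ⟩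
        d (L i) p              ≤⟨ d.triangle (L i) (C i) p ⟩
        d (L i) (C i) + d (C i) p ∎)

    -- Since `C i` is already at the request, the move of its lazy partner costs exactly the `i`-th
    -- term, which then drops to zero.
    serve-potential : ∀ L L′ C i r → C i ≈ r → L′ i ≡ r → (∀ j → j ≢ i → L′ j ≡ L j) →
      d (L i) r + potential L′ C ≤ potential L C
    serve-potential L L′ C i r Ci≈r L′i≡r L′≡L = begin
      d (L i) r + potential L′ C
        ≤⟨ sum-update i (λ j → d (L j) (C j)) (λ j → d (L′ j) (C j)) (d (L i) r) 0ℝ
             (λ j j≢i → cong (λ x → d x (C j)) (L′≡L j j≢i)) step ⟩
      potential L C + 0ℝ
        ≈⟨ identityʳ (potential L C) ⟩
      potential L C ∎
      where
      open ≤-Reasoning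
      step : d (L i) r + d (L′ i) (C i) ≤ d (L i) (C i) + 0ℝ
      step = begin
        d (L i) r + d (L′ i) (C i)
          ≈⟨ ∙-cong {d (L i) r} {d (L i) (C i)} {d (L′ i) (C i)} {0ℝ}
               (d.cong d.EqC.refl (d.EqC.sym Ci≈r))
               (d.≈⇒0 (d.EqC.trans (d.EqC.reflexive L′i≡r) (d.EqC.sym Ci≈r))) ⟩
        d (L i) (C i) + 0ℝ ∎

  open Potential

  module Simulation (em : ExcludedMiddle ℓ) {k} (A : OnlineAlgorithm (finite k)) where

    open OnlineAlgorithm A

    C : History → Configuration (finite k)
    C = configuration respond

    C-cong : ∀ {h h′} → h ≋ h′ → ∀ i → C h i ≈ C h′ i
    C-cong []             i = d.EqC.refl
    C-cong (r≈r′ ∷ h≋h′) i = perform-cong (C-cong h≋h′) (respond-cong h≋h′ r≈r′) i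

    -- The server named by serves need not respect _≈_, the least one does.
    leastServer : ∀ h r → Least λ n → ∃[ i ] (toℕ i ≡ n × C (r ∷ h) i ≈ r)
    leastServer h r = least em (let i , Ci≈r = serves h r in toℕ i , i , refl , Ci≈r)

    server : History → Point → Fin k
    server h r = proj₁ (proj₁ (proj₂ (leastServer h r)))

    server-serves : ∀ h r → C (r ∷ h) (server h r) ≈ r
    server-serves h r = proj₂ (proj₂ (proj₁ (proj₂ (leastServer h r))))

    server-cong : ∀ {h h′ r r′} → h ≋ h′ → r ≈ r′ → server h r ≡ server h′ r′
    server-cong {h} {h′} {r} {r′} h≋h′ r≈r′ = toℕ-injective
      (trans (proj₁ (proj₂ (proj₁ (proj₂ (leastServer h r)))))
      (trans (least-unique (leastServer h r) (leastServer h′ r′)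
        (λ (i , eq , Ci≈r) → i , eq , d.EqC.trans
          (d.EqC.trans (d.EqC.sym (C-cong (r≈r′ ∷ h≋h′) i)) Ci≈r) r≈r′)
        (λ (i , eq , Ci≈r′) → i , eq , d.EqC.trans
          (d.EqC.trans (C-cong (r≈r′ ∷ h≋h′) i) Ci≈r′) (d.EqC.sym r≈r′)))
      (sym (proj₁ (proj₂ (proj₁ (proj₂ (leastServer h′ r′))))))))

    -- Servers of A correspond to those of the lazy algorithm via label. Those
    -- with labels at least length h have not served any request, and the next
    -- of them to do so exchanges its label for length h.
    label  : History → Fin k → ℕ
    choose : History → Point → ℕ

    choose h r = label h (server h r) ⊓ length h

    label []      i = toℕ i
    -- If the serving label is at most `length h`, both arguments of the swap coincide and no label
    -- changes.
    label (r ∷ h) i = swap (label h (server h r)) (choose h r) (label h i)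

    label-cong  : ∀ {h h′} → h ≋ h′ → label h ≗ label h′
    choose-cong : ∀ {h h′ r r′} → h ≋ h′ → r ≈ r′ → choose h r ≡ choose h′ r′

    choose-cong {h′ = h′} {r = r} h≋h′ r≈r′ = cong₂ _⊓_
      (trans (label-cong h≋h′ _) (cong (label h′) (server-cong h≋h′ r≈r′)))
      (Pointwise.Pointwise-length h≋h′)

    label-cong []                                       i = refl
    label-cong {r ∷ h} {r′ ∷ h′} (r≈r′ ∷ h≋h′) i
      rewrite label-cong h≋h′ i | choose-cong h≋h′ r≈r′
            | label-cong h≋h′ (server h r) | server-cong h≋h′ r≈r′ = refl

    lazyRule : Rule
    lazyRule = record
      { choose      = choose
      ; choose≤     = λ h r → ℕ.m⊓n≤n (label h (server h r)) (length h)
      ; choose-cong = choose-cong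
      }

    label-injective : ∀ h {i j} → label h i ≡ label h j → i ≡ j
    label-injective []      eq = toℕ-injective eq
    label-injective (r ∷ h) eq = label-injective h
      (swap-injective (label h (server h r)) (choose h r) eq)

    label-server : ∀ h r → label (r ∷ h) (server h r) ≡ choose h r
    label-server h r = swap-left (label h (server h r)) (choose h r)

    X : History → Configuration unbounded
    X = configuration (chase choose)

    X-fresh : ∀ h {n} → length h ℕ.≤ n → X h n ≡ s
    X-fresh []      _ = refl
    X-fresh (r ∷ h) {n} h<n = trans
      (move-other (X h) r λ n≡e → ℕ.<-irrefl (sym n≡e)
        (ℕ.≤-<-trans (Rule.choose≤ lazyRule h r) h<n))
      (X-fresh h (ℕ.<⇒≤ h<n))

    -- The two swapped labels either coincide or belong to servers still at the source, so
    -- relabelling displaces nothing.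
    X-server : ∀ h r → X h (label h (server h r)) ≡ X h (choose h r)
    X-server h r with ℕ.≤-total (label h (server h r)) (length h)
    ... | inj₁ l≤n rewrite ℕ.m≤n⇒m⊓n≡m l≤n = refl
    ... | inj₂ n≤l rewrite ℕ.m≥n⇒m⊓n≡n n≤l =
      trans (X-fresh h n≤l) (sym (X-fresh h ℕ.≤-refl))

    -- The lazy configuration as seen through the servers of `A`, which makes it comparable with
    -- `C h`.
    L : History → Configuration (finite k)
    L h i = X h (label h i)

    L-server : ∀ h r → L (r ∷ h) (server h r) ≡ r
    L-server h r = trans (cong (X (r ∷ h)) (label-server h r))
      (move-self (X h) (choose h r) r)

    L-other : ∀ h r j → j ≢ server h r → L (r ∷ h) j ≡ L h j
    L-other h r j j≢i = trans
      (move-other (X h) r λ eq → j≢i (label-injective (r ∷ h) (trans eq (sym (label-server h r)))))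
      (swap-invariant (X h) (label h (server h r)) (choose h r) (X-server h r) (label h j))

    -- Amortisation: in each step, the lazy cost plus the new potential is at most the old potential
    -- plus the cost of `A`.
    run-lazy≤ : ∀ h σ →
      cost (OnlineAlgorithm.run (lazy lazyRule) h σ) ≤ potential (L h) (C h) + cost (run h σ)
    run-lazy≤ h [] = begin
      0ℝ                            ≤⟨ sum-nonNegative (λ i → d (L h i) (C h i)) (λ i → d.nonNegative) ⟩
      potential (L h) (C h)         ≈⟨ identityʳ (potential (L h) (C h)) ⟨
      potential (L h) (C h) + 0ℝ    ∎
      where open ≤-Reasoning
    run-lazy≤ h (r ∷ σ) = begin
      (d (X h (choose h r)) r + 0ℝ) + lazyCost
        ≈⟨ ∙-congʳ {lazyCost} {d (X h (choose h r)) r + 0ℝ}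
             {d (X h (choose h r)) r} (identityʳ (d (X h (choose h r)) r)) ⟩
      d (X h (choose h r)) r + lazyCost
        ≡⟨ cong (λ x → d x r + lazyCost) (X-server h r) ⟨
      d (L h i) r + lazyCost
        ≤⟨ +-mono-≤ {d (L h i) r} {d (L h i) r} {lazyCost} {Φ′ + rest}
             (≤-refl {d (L h i) r}) (run-lazy≤ (r ∷ h) σ) ⟩
      d (L h i) r + (Φ′ + rest)
        ≈⟨ assoc (d (L h i) r) Φ′ rest ⟨
      d (L h i) r + Φ′ + rest
        ≤⟨ +-mono-≤ {d (L h i) r + Φ′} {Φ + distance (C h) (respond h r)} {rest} {rest}
             step (≤-refl {rest}) ⟩
      Φ + distance (C h) (respond h r) + rest
        ≈⟨ assoc Φ (distance (C h) (respond h r)) rest ⟩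
      Φ + (distance (C h) (respond h r) + rest) ∎
      where
      open ≤-Reasoning
      i        = server h r
      lazyCost = cost (OnlineAlgorithm.run (lazy lazyRule) (r ∷ h) σ)
      rest     = cost (run (r ∷ h) σ)
      Φ        = potential (L h) (C h)
      Φ′       = potential (L (r ∷ h)) (C (r ∷ h))
      step : d (L h i) r + Φ′ ≤ Φ + distance (C h) (respond h r)
      step = begin
        d (L h i) r + Φ′                  ≤⟨ serve-potential (L h) (L (r ∷ h)) (C (r ∷ h)) i r
                                               (server-serves h r) (L-server h r) (L-other h r) ⟩
        potential (L h) (C (r ∷ h))       ≤⟨ perform-potential (L h) (C h) (respond h r) ⟩
        Φ + distance (C h) (respond h r)  ∎

    lazy-ALG≤ : ∀ σ → OnlineAlgorithm.ALG (lazy lazyRule) σ ≤ ALG σ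
    lazy-ALG≤ σ = begin
      OnlineAlgorithm.ALG (lazy lazyRule) σ  ≤⟨ run-lazy≤ [] σ ⟩
      -- All servers start at `s`, so the initial potential vanishes.
      potential (L []) (C []) + ALG σ        ≈⟨ ∙-congʳ {ALG σ} {potential (L []) (C [])} {0ℝ}
                                                  (sum-zero (λ i → d (L [] i) (C [] i)) λ _ → d.≈⇒0 d.EqC.refl) ⟩
      0ℝ + ALG σ                             ≈⟨ identityˡ (ALG σ) ⟩
      ALG σ                                  ∎
      where open ≤-Reasoning

-- Competitiveness of the limit algorithm

theorem2 : ∀ {a ℓ : Level} → ExcludedMiddle (a ⊔ ℓ) →
    (M : MetricSpace a ℓ) (s : MetricSpace.Carrier M) →
    let open ServerProblem M s in
    (ρ : ℝ) →
    ((h : ℕ) → 1 ℕ.≤ h →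
    ∃[ k ] (h ℕ.≤ k × (∃[ A ] StrictlyCompetitive ρ (finite h) (finite k) A))) →
    ∃[ A ] StrictlyCompetitive ρ unbounded unbounded A
theorem2 {a} {ℓ} em M s ρ competitive = lazy M s limitRule , λ σ opt isOPT →
  let N , isOPT-finite = OPT-finite M s σ opt isOPT
      -- As `n` is at least `N`, `opt` is also optimal for `suc n` servers; as `n` survives,
      -- `rule n` chooses on `σ` as the limit does.
      n , N≤n , survives = frequent (σ ʳ++ []) N
      A , A-competitive = proj₂ (proj₂ (given n))
  in subst (_≤ ρ * opt)
       (run-agree M s (rule n) limitRule [] σ (survives⇒agree (σ ʳ++ []) survives))
       (≤-trans {ALG (lazy M s (rule n)) σ} {ALG A σ} {ρ * opt}
         (Simulation.lazy-ALG≤ M s em-ℓ A σ)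
         (A-competitive σ opt (isOPT-finite n N≤n)))
  where
  open ServerProblem M s
  open OnlineAlgorithm using (ALG)
  em-ℓ : ExcludedMiddle ℓ
  em-ℓ = lowerEM ℓ a em
  -- Index `n` stands for `suc n` offline servers, which is positive and matches the fleets in
  -- `OPT-finite`.
  given : ∀ n → ∃[ k ] (suc n ℕ.≤ k × (∃[ A ] StrictlyCompetitive ρ (finite (suc n)) (finite k) A))
  given n = competitive (suc n) (ℕ.s≤s ℕ.z≤n)
  rule : ℕ → Rule M s
  rule n = Simulation.lazyRule M s em-ℓ (proj₁ (proj₂ (proj₂ (given n))))
  open Limit M s (lowerEM 0ℓ (a ⊔ ℓ) em) rule
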